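{- Let $b\ge2$ be an integer. Then the sequence $(\mathrm{lnzd}_b(n!))_{n\ge1}$ is eventually periodic if and only if $b=2$.
   Context: For integers $b\ge2$ and $n\ge1$, let $v_b(n)=\max\{e\ge0: b^e\mid n\}$ and $U_b(n)=n/b^{v_b(n)}$. The last nonzero digit of $n$ in base $b$, $\mathrm{lnzd}_b(n)$, is the unique integer with $1\le \mathrm{lnzd}_b(n)\le b-1$ and $\mathrm{lnzd}_b(n)\equiv U_b(n)\pmod b$. -}

module Defs where

open import Data.Nat using (ℕ; zero; suc; _+_; _*_; _≤_; _≥_; _≡ᵇ_; NonZero)
open import Data.Nat.DivMod using (_/_; _%_)
open import Data.Bool using (if_then_else_)
open import Data.Product using (∃; _×_)
open import Relation.Binary.PropositionalEquality using (_≡_)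

stripAux : (b : ℕ) → .{{NonZero b}} → (fuel n : ℕ) → ℕ
stripAux b zero    n = n
stripAux b (suc f) zero = zero
stripAux b (suc f) (suc m) =
  if (suc m % b) ≡ᵇ 0 then stripAux b f (suc m / b) else suc m

-- U_b(n) = n / b^(v_b(n)).  For b ≥ 2 and n ≥ 1 we have v_b(n) < n,
-- so fuel n suffices to strip all trailing zeros.
U : (b : ℕ) → .{{NonZero b}} → ℕ → ℕ
U b n = stripAux b n n

lnzd : (b : ℕ) → .{{NonZero b}} → ℕ → ℕ
lnzd b n = U b n % b

EventuallyPeriodic : (ℕ → ℕ) → Set
EventuallyPeriodic a = ∃ λ N → ∃ λ p → (p ≥ 1) × (∀ n → n ≥ N → a (n + p) ≡ a n)

{-# OPTIONS --safe #-}
-- If the digits have period p beyond N, choose P coprime to b and k large with p ∣ P * b ^ k, and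
-- compare (M - 1)! and M! at M = P * b ^ k and at M = 2 * P * b ^ k.  With d the common last nonzero
-- digit of the two (M - 1)!, those of the two M! are d P and 2 d P modulo b, which differ, unless
-- b ∣ 2 d.  In that case b = 2 h and d = h, and the second digit is odd while the first is h P, so
-- h is odd.  But then (M - 1)! = u * b ^ e with u an odd multiple of h, so that an odd prime q ∣ h
-- divides (M - 1)! more often than 2 does, which is impossible.
module Submission where

open import Defs
open import Data.Bool using (true; false; T)
open import Data.Empty using (⊥; ⊥-elim)
open import Data.List using ([]; _∷_)
open import Data.List.Relation.Unary.All using (_∷_)
open import Data.Nat using (ℕ; zero; suc; _+_; _*_; _∸_; _^_; _≤_; _<_; _≡ᵇ_; z≤n; s≤s; s≤s⁻¹; NonZero; _!; >-nonZero; nonTrivial⇒n>1)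
open import Data.Nat.Coprimality as Coprimality using (Coprime; coprime?; coprime-divisor)
open import Data.Nat.DivMod
open import Data.Nat.Divisibility
open import Data.Nat.GCD using (gcd; gcd[m,n]∣m; gcd[m,n]∣n)
open import Data.Nat.Induction using (<-rec)
open import Data.Nat.Primality using (Prime; prime[2]; prime⇒nonZero; prime⇒nonTrivial; prime⇒irreducible; euclidsLemma; ¬prime[1])
open import Data.Nat.Primality.Factorisation using (factorise)
open import Data.Nat.Properties
open import Data.Nat.Tactic.RingSolver using (solve-∀)
open import Data.Product using (∃; ∃₂; _×_; _,_)
open import Data.Sum using (_⊎_; inj₁; inj₂; [_,_]′)
open import Function using (_∘_)
open import Function.Bundles using (_⇔_; mk⇔)
open import Relation.Binary.PropositionalEquality using (_≡_; _≢_; refl; sym; trans; cong; cong₂; subst; module ≡-Reasoning)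
open import Relation.Nullary using (Dec; yes; no; contradiction)

-- Powers, congruences and parity.

n<b^n : ∀ {b} → 2 ≤ b → ∀ n → n < b ^ n
n<b^n 2≤b zero = s≤s z≤n
n<b^n {b} 2≤b (suc n) = begin
  2 + n          ≤⟨ s≤s (s≤s (m≤n+m n n)) ⟩
  2 + (n + n)    ≡⟨ double n ⟩
  2 * suc n      ≤⟨ *-mono-≤ 2≤b (n<b^n 2≤b n) ⟩
  b * b ^ n      ∎
  where
  open ≤-Reasoning
  double : ∀ n → 2 + (n + n) ≡ 2 * suc n
  double = solve-∀

^-monoˡ-∣ : ∀ {m n} e → m ∣ n → m ^ e ∣ n ^ e
^-monoˡ-∣ zero m∣n = ∣-refl
^-monoˡ-∣ (suc e) m∣n = *-pres-∣ m∣n (^-monoˡ-∣ e m∣n)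

%-≡⇒∣∸ : ∀ x y b .{{_ : NonZero b}} → x % b ≡ y % b → b ∣ y ∸ x
%-≡⇒∣∸ x y b eq = subst (b ∣_) (sym y∸x) (divides (y / b ∸ x / b) (sym (*-distribʳ-∸ b (y / b) (x / b))))
  where
  open ≡-Reasoning
  y∸x : y ∸ x ≡ y / b * b ∸ x / b * b
  y∸x = begin
    y ∸ x                                           ≡⟨ cong₂ _∸_ (m≡m%n+[m/n]*n y b) (m≡m%n+[m/n]*n x b) ⟩
    (y % b + y / b * b) ∸ (x % b + x / b * b)       ≡⟨ cong (λ r → (y % b + y / b * b) ∸ (r + x / b * b)) eq ⟩
    (y % b + y / b * b) ∸ (y % b + x / b * b)       ≡⟨ [m+n]∸[m+o]≡n∸o (y % b) _ _ ⟩
    y / b * b ∸ x / b * b                           ∎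

∣-resp-% : ∀ {d x y b} .{{_ : NonZero b}} → x % b ≡ y % b → d ∣ b → d ∣ x → d ∣ y
∣-resp-% {d} eq d∣b d∣x = ∣n∣m%n⇒∣m d∣b (subst (d ∣_) eq (%-presˡ-∣ d∣x d∣b))

%-cong-* : ∀ {x y} z b .{{_ : NonZero b}} → x % b ≡ y % b → (x * z) % b ≡ (y * z) % b
%-cong-* {x} {y} z b eq = begin
  (x * z) % b                 ≡⟨ %-distribˡ-* x z b ⟩
  ((x % b) * (z % b)) % b     ≡⟨ cong (λ r → (r * (z % b)) % b) eq ⟩
  ((y % b) * (z % b)) % b     ≡⟨ %-distribˡ-* y z b ⟨
  (y * z) % b                 ∎
  where open ≡-Reasoning

2∣⊎coprime : ∀ n → 2 ∣ n ⊎ Coprime n 2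
2∣⊎coprime n with 2 ∣? n
... | yes 2∣n = inj₁ 2∣n
... | no 2∤n = inj₂ λ {i} (i∣n , i∣2) →
  [ (λ i≡1 → i≡1) , (λ i≡2 → contradiction (subst (_∣ n) i≡2 i∣n) 2∤n) ]′ (prime⇒irreducible prime[2] i∣2)

-- Multiplicities of primes in factorials.

prime∤* : ∀ {q m n} → Prime q → q ∤ m → q ∤ n → q ∤ m * n
prime∤* {m = m} {n} q-prime q∤m q∤n = [ q∤m , q∤n ]′ ∘ euclidsLemma m n q-prime

prime∤^ : ∀ {q m} → Prime q → q ∤ m → ∀ e → q ∤ m ^ e
prime∤^ q-prime q∤m zero q∣1 = ¬prime[1] (subst Prime (∣1⇒≡1 q∣1) q-prime)
prime∤^ q-prime q∤m (suc e) = prime∤* q-prime q∤m (prime∤^ q-prime q∤m e)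

-- Euclid's lemma puts one `q` into `x`; cancelling it on both sides leaves the claim for `e`.
prime^-cancelʳ-∣ : ∀ {q x c} → Prime q → q ∤ c → ∀ e → q ^ e ∣ x * c → q ^ e ∣ x
prime^-cancelʳ-∣ q-prime q∤c zero _ = 1∣ _
prime^-cancelʳ-∣ {q} {x} {c} q-prime q∤c (suc e) q^∣xc
  with euclidsLemma x c q-prime (m*n∣⇒m∣ q (q ^ e) q^∣xc)
... | inj₂ q∣c = contradiction q∣c q∤c
... | inj₁ (divides y refl) =
  subst (q * q ^ e ∣_) (*-comm q y) (*-monoʳ-∣ q (prime^-cancelʳ-∣ q-prime q∤c e q^e∣yc))
  where
  instance _ = prime⇒nonZero q-prime
  rearrange : ∀ y q c → y * q * c ≡ q * (y * c)
  rearrange = solve-∀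
  q^e∣yc : q ^ e ∣ y * c
  q^e∣yc = *-cancelˡ-∣ q (subst (q * q ^ e ∣_) (rearrange y q c) q^∣xc)

prime-divisor : ∀ n → .{{NonZero n}} → n ≢ 1 → ∃ λ q → Prime q × q ∣ n
prime-divisor n n≢1 with factorise n
... | record { factors = [] ; isFactorisation = n≡1 } = contradiction n≡1 n≢1
... | record { factors = q ∷ qs ; isFactorisation = n≡ ; factorsPrime = q-prime ∷ _ } =
  q , q-prime , subst (q ∣_) (sym n≡) (m∣m*n _)

-- The first step of Legendre's formula.
!-decomposition : ∀ {q} → Prime q → ∀ m r → r < q → ∃ λ c → (r + m * q) ! ≡ m ! * q ^ m * c × q ∤ c
!-decomposition q-prime zero zero _ = 1 , refl , λ q∣1 → ¬prime[1] (subst Prime (∣1⇒≡1 q∣1) q-prime)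
!-decomposition {q@(suc r)} q-prime (suc m) zero _ with !-decomposition q-prime m r ≤-refl
... | c , eq , q∤c = c , trans (cong (suc m * q *_) eq) (rearrange (suc m) q (m !) (q ^ m) c) , q∤c
  where
  rearrange : ∀ s q f t c → s * q * (f * t * c) ≡ s * f * (q * t) * c
  rearrange = solve-∀
!-decomposition {q} q-prime m (suc r) r<q with !-decomposition q-prime m r (<-trans (n<1+n r) r<q)
... | c , eq , q∤c =
  (suc r + m * q) * c , trans (cong ((suc r + m * q) *_) eq) (rearrange (suc r + m * q) (m ! * q ^ m) c) ,
  prime∤* q-prime q∤n q∤c
  where
  rearrange : ∀ n a c → n * (a * c) ≡ a * (n * c)
  rearrange = solve-∀
  q∤n : q ∤ suc r + m * q
  q∤n q∣n = <⇒≱ r<q (∣⇒≤ (∣m+n∣m⇒∣n (subst (q ∣_) (+-comm (suc r) (m * q)) q∣n) (n∣m*n m)))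

-- With `m = n / q`, the multiplicity of `q` in `n !` is `m` plus that in `m !`. By strong induction
-- the latter is at most m/2, and m + m/2 = 3m/2 ≤ qm/2 ≤ n/2.
prime^∣!⇒≤ : ∀ {q} → Prime q → 3 ≤ q → ∀ n f → q ^ f ∣ n ! → f * 2 ≤ n
prime^∣!⇒≤ {q} q-prime 3≤q = <-rec _ go
  where
  instance _ = prime⇒nonZero q-prime
  open ≤-Reasoning

  go : ∀ n → (∀ {m} → m < n → ∀ f → q ^ f ∣ m ! → f * 2 ≤ m) → ∀ f → q ^ f ∣ n ! → f * 2 ≤ n
  go zero _ zero _ = z≤n
  go zero _ (suc f) q^∣1 =
    contradiction (subst Prime (∣1⇒≡1 (m*n∣⇒m∣ q (q ^ f) q^∣1)) q-prime) ¬prime[1]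
  go n@(suc _) rec f q^∣n! with f ≤? n / q
  -- The bound is immediate here; in the other case `f ∸ m` is a true difference.
  ... | yes f≤m = begin
    f * 2       ≤⟨ *-mono-≤ f≤m (≤-trans (n≤1+n 2) 3≤q) ⟩
    n / q * q   ≤⟨ m/n*n≤m n q ⟩
    n           ∎
  ... | no f≰m with !-decomposition q-prime (n / q) (n % q) (m%n<n n q)
  ...   | c , n!≡ , q∤c = begin
    f * 2             ≡⟨ cong (_* 2) (m∸n+n≡m (≰⇒≥ f≰m)) ⟨
    (g + m) * 2       ≡⟨ *-distribʳ-+ 2 g m ⟩
    g * 2 + m * 2     ≤⟨ +-monoˡ-≤ (m * 2) (rec (m/n<m n q (≤-trans (n≤1+n 2) 3≤q)) g q^g∣m!) ⟩
    m + m * 2         ≡⟨ *-suc m 2 ⟨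
    m * 3             ≤⟨ *-monoʳ-≤ m 3≤q ⟩
    m * q             ≤⟨ m/n*n≤m n q ⟩
    n                 ∎
    where
    m = n / q
    g = f ∸ m
    instance _ = m^n≢0 q m
    q^f≡ : q ^ f ≡ q ^ m * q ^ g
    q^f≡ = trans (cong (q ^_) (sym (m+[n∸m]≡n (≰⇒≥ f≰m)))) (^-distribˡ-+-* q m g)
    rearrange : ∀ x y z → x * y * z ≡ y * (x * z)
    rearrange = solve-∀
    n!≡′ : n ! ≡ q ^ m * (m ! * c)
    n!≡′ = trans (cong _! (m≡m%n+[m/n]*n n q)) (trans n!≡ (rearrange (m !) (q ^ m) c))
    q^g∣m! : q ^ g ∣ m !
    q^g∣m! = prime^-cancelʳ-∣ q-prime q∤c g (*-cancelˡ-∣ (q ^ m) (subst (q ^ m * q ^ g ∣_) n!≡′ (subst (_∣ n !) q^f≡ q^∣n!)))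

2^n∣[n*2]! : ∀ n → 2 ^ n ∣ (n * 2) !
2^n∣[n*2]! zero = ∣-refl
2^n∣[n*2]! (suc n) =
  *-pres-∣ {2} {suc (suc (n * 2))} (divides (suc n) refl) (∣n⇒∣m*n (suc (n * 2)) (2^n∣[n*2]! n))

-- Since 2f ≤ n, `2 ^ f` divides (2f)!, which divides `n !`. Thus 2 occurs in a factorial at least
-- as often as any odd prime.
odd-prime^∣!⇒2^∣! : ∀ {q} → Prime q → 3 ≤ q → ∀ n f → q ^ f ∣ n ! → 2 ^ f ∣ n !
odd-prime^∣!⇒2^∣! q-prime 3≤q n f q^∣n! =
  ∣-trans (2^n∣[n*2]! f) (m≤n⇒m!∣n! (prime^∣!⇒≤ q-prime 3≤q n f q^∣n!))

-- Splitting a period relative to the base.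

-- Strong induction on `p`: while `gcd p b` exceeds 1, dividing `p` by it makes `p` smaller, and the
-- removed factor is absorbed by one more factor `b`.
∣-coprime*power : ∀ b p → .{{NonZero p}} → ∃₂ λ P k → Coprime P b × p ∣ P * b ^ k
∣-coprime*power b p@(suc _) = <-rec (λ p → 1 ≤ p → ∃₂ λ P k → Coprime P b × p ∣ P * b ^ k) go p (s≤s z≤n)
  where
  go : ∀ p → (∀ {m} → m < p → 1 ≤ m → ∃₂ λ P k → Coprime P b × m ∣ P * b ^ k) →
       1 ≤ p → ∃₂ λ P k → Coprime P b × p ∣ P * b ^ k
  go p rec 1≤p with coprime? p b
  ... | yes coprime = p , 0 , coprime , divides 1 (trans (*-identityʳ p) (sym (*-identityˡ p)))
  ... | no ¬coprime with gcd[m,n]∣m p b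
  ...   | divides zero refl = contradiction 1≤p λ ()
  ...   | divides m@(suc _) p≡m*g with rec m<p (s≤s z≤n)
    where
    g = gcd p b
    g≢0 : g ≢ 0
    g≢0 g≡0 = contradiction (trans p≡m*g (trans (cong (m *_) g≡0) (*-zeroʳ m))) (λ { refl → contradiction 1≤p λ () })
    1<g : 1 < g
    1<g = ≤∧≢⇒< (n≢0⇒n>0 g≢0) (¬coprime ∘ Coprimality.gcd≡1⇒coprime ∘ sym)
    m<p : m < p
    m<p = subst (m <_) (sym p≡m*g) (m<m*n m g 1<g)
  ...     | P , k , coprime , m∣ = P , suc k , coprime ,
    subst (p ∣_) (rearrange P (b ^ k) b) (subst (_∣ P * b ^ k * b) (sym p≡m*g) (*-pres-∣ m∣ (gcd[m,n]∣n p b)))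
    where
    rearrange : ∀ P t b → P * t * b ≡ P * (b * t)
    rearrange = solve-∀

-- Computing the last nonzero digit.

-- Factors `b` are cancelled in pairs until one exponent is 0; a factor `b` left on the other side
-- would divide `u` or `v`. This works for composite `b` too.
*^-unique : ∀ {b} → .{{NonZero b}} → ∀ {u v} e f → b ∤ u → b ∤ v → u * b ^ e ≡ v * b ^ f → u ≡ v
*^-unique {b} {u} {v} zero zero _ _ eq = trans (sym (*-identityʳ u)) (trans eq (*-identityʳ v))
*^-unique {b} {u} {v} zero (suc f) b∤u _ eq =
  contradiction (subst (b ∣_) (trans (sym eq) (*-identityʳ u)) (∣n⇒∣m*n v (m∣m*n (b ^ f)))) b∤u
*^-unique {b} {u} {v} (suc e) zero _ b∤v eq =
  contradiction (subst (b ∣_) (trans eq (*-identityʳ v)) (∣n⇒∣m*n u (m∣m*n (b ^ e)))) b∤v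
*^-unique {b} {u} {v} (suc e) (suc f) b∤u b∤v eq = *^-unique e f b∤u b∤v
  (*-cancelˡ-≡ _ _ b (trans (sym (rearrange u b (b ^ e))) (trans eq (rearrange v b (b ^ f)))))
  where
  rearrange : ∀ u b t → u * (b * t) ≡ b * (u * t)
  rearrange = solve-∀

-- Each division by `b ≥ 2` makes the number smaller, so `n ≤ f` is preserved and the fuel lasts
-- until `b` no longer divides.
stripAux-spec : ∀ b → .{{_ : NonZero b}} → 2 ≤ b → ∀ f n → 1 ≤ n → n ≤ f →
                ∃ λ e → n ≡ stripAux b f n * b ^ e × b ∤ stripAux b f n
stripAux-spec b 2≤b (suc f) (suc m) _ (s≤s m≤f) with suc m % b ≡ᵇ 0 in eq
... | false = 0 , sym (*-identityʳ (suc m)) , λ b∣n → subst (λ r → (r ≡ᵇ 0) ≢ false) (sym (n∣m⇒m%n≡0 (suc m) b b∣n)) (λ ()) eq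
... | true with m%n≡0⇒n∣m (suc m) b (≡ᵇ⇒≡ _ 0 (subst T (sym eq) _))
...   | b∣n with stripAux-spec b 2≤b f (suc m / b) 1≤n/b (≤-trans (s≤s⁻¹ (m/n<m (suc m) b 2≤b)) m≤f)
  where
  1≤n/b : 1 ≤ suc m / b
  1≤n/b = m≥n⇒m/n>0 (∣⇒≤ b∣n)
...     | e , eq′ , b∤ = suc e , trans (sym (m/n*n≡m b∣n)) (trans (cong (_* b) eq′) (rearrange (stripAux b f (suc m / b)) (b ^ e) b)) , b∤
  where
  rearrange : ∀ u t b → u * t * b ≡ u * (b * t)
  rearrange = solve-∀

U-spec : ∀ b → .{{_ : NonZero b}} → 2 ≤ b → ∀ n → .{{NonZero n}} → ∃ λ e → n ≡ U b n * b ^ e × b ∤ U b n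
U-spec b 2≤b n@(suc _) = stripAux-spec b 2≤b n n (s≤s z≤n) ≤-refl

-- Lets a digit be read off from any factorisation, without running `stripAux`.
lnzd-*^ : ∀ b → .{{_ : NonZero b}} → 2 ≤ b → ∀ {n u} e → n ≡ u * b ^ e → b ∤ u → lnzd b n ≡ u % b
lnzd-*^ b 2≤b {n} {zero} e _ b∤u = contradiction (b ∣0) b∤u
lnzd-*^ b 2≤b {n} {u@(suc _)} e n≡ b∤u =
  let f , n≡′ , b∤U = U-spec b 2≤b n {{n≢0}}
  in cong (_% b) (*^-unique f e b∤U b∤u (trans (sym n≡′) n≡))
  where
  n≢0 : NonZero n
  n≢0 = subst NonZero (sym n≡) (m*n≢0 u (b ^ e) {{_}} {{m^n≢0 b e}})

-- Comparing the digits of two factorials.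

-- An odd prime `q` dividing `h` divides `u` once and `(h * 2) ^ e` at least `e` times. So
-- `2 ^ suc e` divides `n !` as well, although `u * h ^ e` is odd.
odd-half⇒⊥ : ∀ {n u h e} → .{{NonZero h}} → 2 ∤ u → h ∣ u → h ≢ 1 → n ! ≡ u * (h * 2) ^ e → ⊥
odd-half⇒⊥ {n} {u} {h} {e} 2∤u h∣u h≢1 n!≡ with prime-divisor h h≢1
... | q , q-prime , q∣h = contradiction 2∣uh^e (prime∤* prime[2] 2∤u (prime∤^ prime[2] 2∤h e))
  where
  2∤h : 2 ∤ h
  2∤h 2∣h = 2∤u (∣-trans 2∣h h∣u)
  3≤q : 3 ≤ q
  3≤q = ≤∧≢⇒< (nonTrivial⇒n>1 q {{prime⇒nonTrivial q-prime}}) λ { refl → 2∤h q∣h }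
  q^∣n! : q ^ suc e ∣ n !
  q^∣n! = subst (q ^ suc e ∣_) (sym n!≡) (*-pres-∣ (∣-trans q∣h h∣u) (^-monoˡ-∣ e (∣-trans q∣h (m∣m*n 2))))
  ^-distribʳ-* : ∀ m n e → (m * n) ^ e ≡ m ^ e * n ^ e
  ^-distribʳ-* m n zero = refl
  ^-distribʳ-* m n (suc e) = trans (cong (m * n *_) (^-distribʳ-* m n e)) (interchange m n (m ^ e) (n ^ e))
    where
    interchange : ∀ a b c d → a * b * (c * d) ≡ a * c * (b * d)
    interchange = solve-∀
  2∣uh^e : 2 ∣ u * h ^ e
  2∣uh^e = *-cancelʳ-∣ (2 ^ e) {{m^n≢0 2 e}} (subst (2 ^ suc e ∣_)
    (trans n!≡ (trans (cong (u *_) (^-distribʳ-* h 2 e)) (sym (*-assoc u (h ^ e) (2 ^ e)))))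
    (odd-prime^∣!⇒2^∣! q-prime 3≤q n (suc e) q^∣n!))

-- With M = `P * b ^ k`, `m !` is (M - 1)! and `n !` is (2M - 1)!; multiplying by M and 2M
-- respectively gives the next factorials.
equal-digits⇒⊥ : ∀ b → .{{_ : NonZero b}} → 2 ≤ b → b ≢ 2 → ∀ {P k m n} → Coprime P b →
  suc m ≡ P * b ^ k → suc n ≡ 2 * (P * b ^ k) →
  lnzd b (m !) ≡ lnzd b (n !) → lnzd b (suc m !) ≡ lnzd b (suc n !) → ⊥
equal-digits⇒⊥ b 2≤b b≢2 {P} {k} {m} {n} coprime m≡ n≡ digits digits⁺
  with U-spec b 2≤b (m !) {{m !≢0}} | U-spec b 2≤b (n !) {{n !≢0}}
... | e , m!≡ , b∤u | f , n!≡ , b∤v = by-cases (b ∣? v * 2)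
  where
  u = U b (m !)
  v = U b (n !)

  suc-m! : suc m ! ≡ u * P * b ^ (k + e)
  suc-m! = begin
    suc m * m !                             ≡⟨ cong₂ _*_ m≡ m!≡ ⟩
    P * b ^ k * (u * b ^ e)                 ≡⟨ lemma P (b ^ k) u (b ^ e) ⟩
    u * P * (b ^ k * b ^ e)                 ≡⟨ cong (u * P *_) (^-distribˡ-+-* b k e) ⟨
    u * P * b ^ (k + e)                     ∎
    where
    open ≡-Reasoning
    lemma : ∀ P s w t → P * s * (w * t) ≡ w * P * (s * t)
    lemma = solve-∀

  suc-n! : suc n ! ≡ v * 2 * P * b ^ (k + f)
  suc-n! = begin
    suc n * n !                             ≡⟨ cong₂ _*_ n≡ n!≡ ⟩
    2 * (P * b ^ k) * (v * b ^ f)           ≡⟨ lemma P (b ^ k) v (b ^ f) ⟩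
    v * 2 * P * (b ^ k * b ^ f)             ≡⟨ cong (v * 2 * P *_) (^-distribˡ-+-* b k f) ⟨
    v * 2 * P * b ^ (k + f)                 ∎
    where
    open ≡-Reasoning
    lemma : ∀ P s w t → 2 * (P * s) * (w * t) ≡ w * 2 * P * (s * t)
    lemma = solve-∀

  b∤*P : ∀ {x} → b ∤ x → b ∤ x * P
  b∤*P {x} b∤x b∣xP = b∤x (coprime-divisor (Coprimality.sym coprime) (subst (b ∣_) (*-comm x P) b∣xP))

  digit-m : lnzd b (suc m !) ≡ (u * P) % b
  digit-m = lnzd-*^ b 2≤b (k + e) suc-m! (b∤*P b∤u)

  by-cases : Dec (b ∣ v * 2) → ⊥
  -- The digits give uP ≡ 2vP ≡ 2uP modulo `b`, so `b` would divide uP.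
  by-cases (no b∤2v) = b∤*P b∤u (subst (b ∣_) (2x∸x u P) (%-≡⇒∣∸ (u * P) (u * (2 * P)) b uP≡2uP))
    where
    2x∸x : ∀ u P → u * (2 * P) ∸ u * P ≡ u * P
    2x∸x u P = trans (cong (_∸ u * P) (lemma u P)) (m+n∸n≡m (u * P) (u * P))
      where
      lemma : ∀ u P → u * (2 * P) ≡ u * P + u * P
      lemma = solve-∀
    uP≡2uP : (u * P) % b ≡ (u * (2 * P)) % b
    uP≡2uP = begin
      (u * P) % b          ≡⟨ digit-m ⟨
      lnzd b (suc m !)     ≡⟨ digits⁺ ⟩
      lnzd b (suc n !)     ≡⟨ lnzd-*^ b 2≤b (k + f) suc-n! (b∤*P b∤2v) ⟩
      (v * 2 * P) % b      ≡⟨ cong (_% b) (*-assoc v 2 P) ⟩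
      (v * (2 * P)) % b    ≡⟨ %-cong-* (2 * P) b digits ⟨
      (u * (2 * P)) % b    ∎
      where open ≡-Reasoning
  by-cases (yes b∣2v) with 2∣⊎coprime b
  ... | inj₂ b-odd = b∤v (coprime-divisor b-odd (subst (b ∣_) (*-comm v 2) b∣2v))
  ... | inj₁ 2∣b@(divides h b≡h*2) with b∣2v
  ...   | divides o v*2≡o*b = odd-half⇒⊥ {n} {v} {h} {f} {{h≢0}} 2∤v (divides o v≡o*h) h≢1
      (subst (λ x → n ! ≡ v * x ^ f) b≡h*2 n!≡)
    where
    v≡o*h : v ≡ o * h
    v≡o*h = *-cancelʳ-≡ v (o * h) 2 (trans v*2≡o*b (trans (cong (o *_) b≡h*2) (sym (*-assoc o h 2))))
    h≢0 : NonZero h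
    h≢0 = >-nonZero (n≢0⇒n>0 λ { refl → contradiction (subst (2 ≤_) b≡h*2 2≤b) λ () })
    h≢1 : h ≢ 1
    h≢1 refl = b≢2 b≡h*2
    -- An even `o` would make `v = o * h` a multiple of `b = h * 2`.
    2∤o : 2 ∤ o
    2∤o (divides o′ refl) = b∤v (divides o′ (trans v≡o*h
      (trans (*-assoc o′ 2 h) (cong (o′ *_) (trans (*-comm 2 h) (sym b≡h*2))))))
    2∤P : 2 ∤ P
    2∤P 2∣P = contradiction (coprime (2∣P , 2∣b)) λ ()
    2∤oP : 2 ∤ o * P
    2∤oP = prime∤* prime[2] 2∤o 2∤P
    -- Doubling `v` creates one more trailing zero, and `o * P`, being odd, is not divisible by the
    -- even base.
    suc-n!′ : suc n ! ≡ o * P * b ^ suc (k + f)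
    suc-n!′ = trans suc-n! (trans (cong (λ x → x * P * b ^ (k + f)) v*2≡o*b) (lemma o b P (b ^ (k + f))))
      where
      lemma : ∀ o b P t → o * b * P * t ≡ o * P * (b * t)
      lemma = solve-∀
    uP≡oP : (u * P) % b ≡ (o * P) % b
    uP≡oP = trans (sym digit-m) (trans digits⁺ (lnzd-*^ b 2≤b (suc (k + f)) suc-n!′ (2∤oP ∘ ∣-trans 2∣b)))
    -- Congruence modulo the even `b` preserves parity: an even `v` would make `u`, then `u * P`,
    -- then `o * P` even.
    2∤v : 2 ∤ v
    2∤v 2∣v = 2∤oP (∣-resp-% uP≡oP 2∣b (∣m⇒∣m*n P (∣-resp-% (sym digits) 2∣b 2∣v)))

-- Periodicity and the base 2.

periodic-multiple : ∀ {a : ℕ → ℕ} {N p} → (∀ n → N ≤ n → a (n + p) ≡ a n) →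
                    ∀ j n → N ≤ n → a (n + j * p) ≡ a n
periodic-multiple {a} periodic zero n N≤n = cong a (+-identityʳ n)
periodic-multiple {a} {N} {p} periodic (suc j) n N≤n =
  trans (cong a (sym (+-assoc n p (j * p))))
    (trans (periodic-multiple {a} periodic j (n + p) (≤-trans N≤n (m≤m+n n p))) (periodic n N≤n))

lnzd-2 : ∀ n → .{{NonZero n}} → lnzd 2 n ≡ 1
lnzd-2 n with U-spec 2 ≤-refl n
... | _ , _ , 2∤U with U 2 n % 2 in eq | m%n<n (U 2 n) 2
...   | 0 | _ = contradiction (m%n≡0⇒n∣m (U 2 n) 2 eq) 2∤U
...   | 1 | _ = refl
...   | suc (suc _) | s≤s (s≤s ())

theorem4p1 : (b : ℕ) → .{{_ : NonZero b}} → 2 ≤ b →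
    EventuallyPeriodic (λ n → lnzd b (suc n !)) ⇔ (b ≡ 2)
theorem4p1 b 2≤b = mk⇔ periodic⇒≡2 ≡2⇒periodic
  where
  ≡2⇒periodic : b ≡ 2 → EventuallyPeriodic (λ n → lnzd b (suc n !))
  ≡2⇒periodic refl = 0 , 1 , ≤-refl , λ n _ →
    trans (lnzd-2 (suc (n + 1) !) {{suc (n + 1) !≢0}}) (sym (lnzd-2 (suc n !) {{suc n !≢0}}))

  periodic⇒≡2 : EventuallyPeriodic (λ n → lnzd b (suc n !)) → b ≡ 2
  periodic⇒≡2 (N , p , p≥1 , periodic) with b ≟ 2
  ... | yes b≡2 = b≡2
  ... | no b≢2 with ∣-coprime*power b p {{>-nonZero p≥1}}
  -- Index `i` carries the digit of (i + 1)!, so (M - 1)! and M! sit at `m = M ∸ 2` and `suc m`.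
  -- Shifting both by `M` gives (2M - 1)! and (2M)!.
  ...   | P , k , coprime , p∣ = ⊥-elim
      (equal-digits⇒⊥ b 2≤b b≢2 {P} {K} {suc m} {suc (m + M)} coprime 2+m≡M 2+m+M≡
        (sym (digit-at m N≤m)) (sym (digit-at (suc m) (m≤n⇒m≤1+n N≤m))))
    where
    -- The surplus exponent `2 + N` keeps `p ∣ M` and forces `M ≥ 2 + N`, so that index `m` lies in
    -- the periodic range.
    K = k + (2 + N)
    M = P * b ^ K
    m = M ∸ 2
    -- 0 is coprime only to 1, and `b ≥ 2`.
    P≢0 : P ≢ 0
    P≢0 refl = <⇒≢ 2≤b (sym (Coprimality.0-coprimeTo-m⇒m≡1 coprime))
    2+N≤M : 2 + N ≤ M
    2+N≤M = begin
      2 + N              ≤⟨ <⇒≤ (n<b^n 2≤b (2 + N)) ⟩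
      b ^ (2 + N)        ≤⟨ ^-monoʳ-≤ b (m≤n+m (2 + N) k) ⟩
      b ^ K              ≤⟨ m≤n*m (b ^ K) P {{>-nonZero (n≢0⇒n>0 P≢0)}} ⟩
      M                  ∎
      where open ≤-Reasoning
    2+m≡M : 2 + m ≡ M
    2+m≡M = m+[n∸m]≡n (≤-trans (m≤m+n 2 N) 2+N≤M)
    2+m+M≡ : 2 + (m + M) ≡ 2 * M
    2+m+M≡ = trans (cong (_+ M) 2+m≡M) (cong (M +_) (sym (+-identityʳ M)))
    N≤m : N ≤ m
    N≤m = ∸-monoˡ-≤ 2 2+N≤M
    p∣M : p ∣ M
    p∣M = subst (p ∣_) (trans (*-assoc P (b ^ k) (b ^ (2 + N))) (cong (P *_) (sym (^-distribˡ-+-* b k (2 + N)))))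
      (∣m⇒∣m*n (b ^ (2 + N)) p∣)
    digit-at : ∀ i → N ≤ i → lnzd b (suc (i + M) !) ≡ lnzd b (suc i !)
    digit-at i N≤i with p∣M
    ... | divides j M≡j*p = subst (λ x → lnzd b (suc (i + x) !) ≡ lnzd b (suc i !)) (sym M≡j*p)
      (periodic-multiple {λ n → lnzd b (suc n !)} periodic j i N≤i)
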